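{- Partially simple bicoloured graphs, i.e. bicoloured graphs in which parallel edges are disallowed for one fixed edge colour only, form a quasitopos. Precisely: fixing one of the two colours, the full subcategory of $\mathsf{BiColGraph}$ on those bicoloured graphs having no two distinct parallel edges of that colour (parallel edges of the other colour being allowed) is a quasitopos.
   Context: $\mathsf{BiColGraph}$ is the category of functors $\mathsf C^{\mathrm{op}}\to\mathsf{Set}$ and natural transformations, where $\mathsf C^{\mathrm{op}}$ has three objects $V,E,E'$ and, besides identities, exactly the four morphisms $s,t\colon E\to V$ and $s',t'\colon E'\to V$. So a bicoloured graph $A$ has vertices $A(V)$, blue edges $A(E)$ and red edges $A(E')$, each with source and target maps. Two edges of the same colour are parallel if they have the same source and the same target. A quasitopos is a category that has all finite limits and finite colimits, is cartesian closed and locally cartesian closed, and has a strong-subobject classifier (a subobject classifier for the class of strong monomorphisms). -}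

module Defs where

open import Level using (Level; _⊔_; 0ℓ) renaming (suc to lsuc)
open import Data.Fin.Base using (Fin)
open import Data.Nat.Base using (ℕ)
open import Data.Product using (Σ; ∃; ∃!; _×_; _,_; proj₁; proj₂)
open import Function.Bundles using (Func; Inverse; _⟨$⟩_; _↔_)
import Function.Construct.Composition as Composition
import Function.Construct.Identity as Identity
import Function.Relation.Binary.Setoid.Equality as FuncEq
open import Relation.Binary.Bundles using (Setoid)
open import Relation.Binary.Structures using (IsEquivalence)
open import Relation.Binary.PropositionalEquality as ≡ using (_≡_)

private
  variable
    o h e o′ h′ e′ p : Level

------------------------------------------------------------------------
-- Categories, with hom-setoids

record Category (o h e : Level) : Set (lsuc (o ⊔ h ⊔ e)) where
  infix  4 _≈_ _⇒_
  infixr 9 _∘_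
  field
    Obj       : Set o
    _⇒_       : Obj → Obj → Set h
    _≈_       : ∀ {A B} → A ⇒ B → A ⇒ B → Set e
    id        : ∀ {A} → A ⇒ A
    _∘_       : ∀ {A B C} → B ⇒ C → A ⇒ B → A ⇒ C
    equiv     : ∀ {A B} → IsEquivalence (_≈_ {A} {B})
    assoc     : ∀ {A B C D} {f : A ⇒ B} {g : B ⇒ C} {k : C ⇒ D} →
                (k ∘ g) ∘ f ≈ k ∘ (g ∘ f)
    identityˡ : ∀ {A B} {f : A ⇒ B} → id ∘ f ≈ f
    identityʳ : ∀ {A B} {f : A ⇒ B} → f ∘ id ≈ f
    ∘-resp-≈  : ∀ {A B C} {f f′ : B ⇒ C} {g g′ : A ⇒ B} →
                f ≈ f′ → g ≈ g′ → f ∘ g ≈ f′ ∘ g′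

  module Equiv {A B : Obj} = IsEquivalence (equiv {A} {B})

  hom-setoid : Obj → Obj → Setoid h e
  hom-setoid A B = record { isEquivalence = equiv {A} {B} }

record Functor (C : Category o h e) (D : Category o′ h′ e′) :
               Set (o ⊔ h ⊔ e ⊔ o′ ⊔ h′ ⊔ e′) where
  private
    module C = Category C
    module D = Category D
  field
    F₀           : C.Obj → D.Obj
    F₁           : ∀ {A B} → A C.⇒ B → F₀ A D.⇒ F₀ B
    F-resp-≈     : ∀ {A B} {f g : A C.⇒ B} → f C.≈ g → F₁ f D.≈ F₁ g
    identity     : ∀ {A} → F₁ (C.id {A}) D.≈ D.id
    homomorphism : ∀ {A B C} {f : A C.⇒ B} {g : B C.⇒ C} →
                   F₁ (g C.∘ f) D.≈ F₁ g D.∘ F₁ f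

record NatTrans {C : Category o h e} {D : Category o′ h′ e′}
                (F G : Functor C D) : Set (o ⊔ h ⊔ h′ ⊔ e′) where
  private
    module C = Category C
    module D = Category D
    module F = Functor F
    module G = Functor G
  field
    η       : ∀ A → F.F₀ A D.⇒ G.F₀ A
    natural : ∀ {A B} (f : A C.⇒ B) → η B D.∘ F.F₁ f D.≈ G.F₁ f D.∘ η A

Functors : Category o h e → Category o′ h′ e′ →
           Category (o ⊔ h ⊔ e ⊔ o′ ⊔ h′ ⊔ e′) (o ⊔ h ⊔ h′ ⊔ e′) (o ⊔ e′)
Functors C D = record
  { Obj       = Functor C D
  ; _⇒_       = NatTrans
  ; _≈_       = λ α β → ∀ A → η α A D.≈ η β A
  ; id        = record
    { η       = λ A → D.id
    ; natural = λ f → D.Equiv.trans D.identityˡ (D.Equiv.sym D.identityʳ)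
    }
  ; _∘_       = λ β α → record
    { η       = λ A → η β A D.∘ η α A
    ; natural = λ f →
        D.Equiv.trans D.assoc
        (D.Equiv.trans (D.∘-resp-≈ D.Equiv.refl (natural α f))
        (D.Equiv.trans (D.Equiv.sym D.assoc)
        (D.Equiv.trans (D.∘-resp-≈ (natural β f) D.Equiv.refl)
         D.assoc)))
    }
  ; equiv     = record
    { refl  = λ A → D.Equiv.refl
    ; sym   = λ eq A → D.Equiv.sym (eq A)
    ; trans = λ eq₁ eq₂ A → D.Equiv.trans (eq₁ A) (eq₂ A)
    }
  ; assoc     = λ A → D.assoc
  ; identityˡ = λ A → D.identityˡ
  ; identityʳ = λ A → D.identityʳ
  ; ∘-resp-≈  = λ eq₁ eq₂ A → D.∘-resp-≈ (eq₁ A) (eq₂ A)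
  }
  where
  module D = Category D
  open NatTrans

-- The category Set: sets are setoids, so that quotients exist.
Sets : ∀ ℓ → Category (lsuc ℓ) ℓ ℓ
Sets ℓ = record
  { Obj       = Setoid ℓ ℓ
  ; _⇒_       = Func
  ; _≈_       = λ {A} {B} → FuncEq._≈_ A B
  ; id        = λ {A} → Identity.function A
  ; _∘_       = λ g f → Composition.function f g
  ; equiv     = λ {A} {B} → FuncEq.isEquivalence A B
  ; assoc     = λ {_} {_} {_} {D} _ → Setoid.refl D
  ; identityˡ = λ {_} {B} _ → Setoid.refl B
  ; identityʳ = λ {_} {B} _ → Setoid.refl B
  ; ∘-resp-≈  = λ {_} {_} {C} {f} {_} {_} {g′} f≈f′ g≈g′ x →
                Setoid.trans C (Func.cong f (g≈g′ x)) (f≈f′ (g′ ⟨$⟩ x))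
  }

FullSubcategory : (C : Category o h e) → (Category.Obj C → Set p) →
                  Category (o ⊔ p) h e
FullSubcategory C P = record
  { Obj       = Σ C.Obj P
  ; _⇒_       = λ A B → proj₁ A C.⇒ proj₁ B
  ; _≈_       = C._≈_
  ; id        = C.id
  ; _∘_       = C._∘_
  ; equiv     = C.equiv
  ; assoc     = C.assoc
  ; identityˡ = C.identityˡ
  ; identityʳ = C.identityʳ
  ; ∘-resp-≈  = C.∘-resp-≈
  }
  where module C = Category C

Slice : (C : Category o h e) → Category.Obj C → Category (o ⊔ h) (h ⊔ e) e
Slice C X = record
  { Obj       = Σ C.Obj (λ A → A C.⇒ X)
  ; _⇒_       = λ (A , a) (B , b) → Σ (A C.⇒ B) (λ f → b C.∘ f C.≈ a)
  ; _≈_       = λ f g → proj₁ f C.≈ proj₁ g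
  ; id        = C.id , C.identityʳ
  ; _∘_       = λ (g , c∘g≈b) (f , b∘f≈a) →
                g C.∘ f ,
                C.Equiv.trans (C.Equiv.sym C.assoc)
                (C.Equiv.trans (C.∘-resp-≈ c∘g≈b C.Equiv.refl) b∘f≈a)
  ; equiv     = record
    { refl = C.Equiv.refl ; sym = C.Equiv.sym ; trans = C.Equiv.trans }
  ; assoc     = C.assoc
  ; identityˡ = C.identityˡ
  ; identityʳ = C.identityʳ
  ; ∘-resp-≈  = C.∘-resp-≈
  }
  where module C = Category C

record IsFinite (J : Category 0ℓ 0ℓ 0ℓ) : Set where
  open Category J
  field
    finite-objects : ∃ λ n → Fin n ↔ Obj
    finite-homs    : ∀ A B → ∃ λ n →
                     Inverse (≡.setoid (Fin n)) (hom-setoid A B)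

------------------------------------------------------------------------
-- Limits and colimits

module _ {J : Category o′ h′ e′} {C : Category o h e} (F : Functor J C) where
  private
    module J = Category J
  open Category C
  open Functor F

  record Cone : Set (o ⊔ h ⊔ e ⊔ o′ ⊔ h′) where
    field
      apex    : Obj
      π       : ∀ j → apex ⇒ F₀ j
      commute : ∀ {i j} (f : i J.⇒ j) → F₁ f ∘ π i ≈ π j

  record Limit : Set (o ⊔ h ⊔ e ⊔ o′ ⊔ h′) where
    field
      cone      : Cone
      universal : (K : Cone) →
                  ∃! _≈_ λ (u : Cone.apex K ⇒ Cone.apex cone) →
                  ∀ j → Cone.π cone j ∘ u ≈ Cone.π K j

  record Cocone : Set (o ⊔ h ⊔ e ⊔ o′ ⊔ h′) where
    field
      coapex  : Obj
      ι       : ∀ j → F₀ j ⇒ coapex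
      commute : ∀ {i j} (f : i J.⇒ j) → ι j ∘ F₁ f ≈ ι i

  record Colimit : Set (o ⊔ h ⊔ e ⊔ o′ ⊔ h′) where
    field
      cocone    : Cocone
      universal : (K : Cocone) →
                  ∃! _≈_ λ (u : Cocone.coapex cocone ⇒ Cocone.coapex K) →
                  ∀ j → u ∘ Cocone.ι cocone j ≈ Cocone.ι K j

HasFiniteLimits : Category o h e → Set (lsuc 0ℓ ⊔ o ⊔ h ⊔ e)
HasFiniteLimits C =
  (J : Category 0ℓ 0ℓ 0ℓ) → IsFinite J → (F : Functor J C) → Limit F

HasFiniteColimits : Category o h e → Set (lsuc 0ℓ ⊔ o ⊔ h ⊔ e)
HasFiniteColimits C =
  (J : Category 0ℓ 0ℓ 0ℓ) → IsFinite J → (F : Functor J C) → Colimit F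

------------------------------------------------------------------------
-- Cartesian closure and subobject classifiers

module _ (C : Category o h e) where
  open Category C

  record Terminal : Set (o ⊔ h ⊔ e) where
    field
      ⊤        : Obj
      !        : ∀ {A} → A ⇒ ⊤
      !-unique : ∀ {A} (f : A ⇒ ⊤) → ! ≈ f

  record Product (A B : Obj) : Set (o ⊔ h ⊔ e) where
    field
      A×B       : Obj
      π₁        : A×B ⇒ A
      π₂        : A×B ⇒ B
      universal : ∀ {X} (f : X ⇒ A) (g : X ⇒ B) →
                  ∃! _≈_ λ (u : X ⇒ A×B) → (π₁ ∘ u ≈ f) × (π₂ ∘ u ≈ g)

    ⟨_,_⟩ : ∀ {X} → X ⇒ A → X ⇒ B → X ⇒ A×B
    ⟨ f , g ⟩ = proj₁ (universal f g)

  module _ (product : ∀ A B → Product A B) where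
    private
      module P {A} {B} = Product (product A B)

      infixr 7 _⊗_
      _⊗_ : Obj → Obj → Obj
      A ⊗ B = Product.A×B (product A B)

    record Exponential (A B : Obj) : Set (o ⊔ h ⊔ e) where
      field
        B^A       : Obj
        eval      : B^A ⊗ A ⇒ B
        universal : ∀ {X} (g : X ⊗ A ⇒ B) →
                    ∃! _≈_ λ (u : X ⇒ B^A) →
                    eval ∘ P.⟨ u ∘ P.π₁ , P.π₂ ⟩ ≈ g

  record CartesianClosed : Set (o ⊔ h ⊔ e) where
    field
      terminal    : Terminal
      product     : ∀ A B → Product A B
      exponential : ∀ A B → Exponential product A B

  Mono : ∀ {A B} → A ⇒ B → Set (o ⊔ h ⊔ e)
  Mono {A} m = ∀ {X} (f g : X ⇒ A) → m ∘ f ≈ m ∘ g → f ≈ g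

  Epi : ∀ {A B} → A ⇒ B → Set (o ⊔ h ⊔ e)
  Epi {_} {B} q = ∀ {X} (f g : B ⇒ X) → f ∘ q ≈ g ∘ q → f ≈ g

  -- A monomorphism with the right lifting property against all
  -- epimorphisms; the diagonal is unique because m is monic.
  StrongMono : ∀ {A B} → A ⇒ B → Set (o ⊔ h ⊔ e)
  StrongMono {A} {B} m =
    Mono m ×
    (∀ {X Y} (q : X ⇒ Y) → Epi q → (f : X ⇒ A) (g : Y ⇒ B) →
     m ∘ f ≈ g ∘ q →
     ∃ λ (d : Y ⇒ A) → (d ∘ q ≈ f) × (m ∘ d ≈ g))

  IsPullback : ∀ {P A B Z} → P ⇒ A → P ⇒ B → A ⇒ Z → B ⇒ Z → Set (o ⊔ h ⊔ e)
  IsPullback {P} {A} {B} p₁ p₂ f g =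
    (f ∘ p₁ ≈ g ∘ p₂) ×
    (∀ {X} (a : X ⇒ A) (b : X ⇒ B) → f ∘ a ≈ g ∘ b →
     ∃! _≈_ λ (u : X ⇒ P) → (p₁ ∘ u ≈ a) × (p₂ ∘ u ≈ b))

  -- A classifier for the subobjects represented by a class M of
  -- monomorphisms.
  record SubobjectClassifier (M : ∀ {A B} → A ⇒ B → Set p) :
                             Set (o ⊔ h ⊔ e ⊔ p) where
    field
      terminal : Terminal
    open Terminal terminal public
    field
      Ω        : Obj
      true     : ⊤ ⇒ Ω
      true∈M   : M true
      classify : ∀ {A B} (m : A ⇒ B) → M m →
                 ∃! _≈_ λ (χ : B ⇒ Ω) → IsPullback m ! χ true

LocallyCartesianClosed : Category o h e → Set (o ⊔ h ⊔ e)
LocallyCartesianClosed C = ∀ X → CartesianClosed (Slice C X)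

record IsQuasitopos (C : Category o h e) : Set (lsuc 0ℓ ⊔ o ⊔ h ⊔ e) where
  field
    finiteLimits           : HasFiniteLimits C
    finiteColimits         : HasFiniteColimits C
    cartesianClosed        : CartesianClosed C
    locallyCartesianClosed : LocallyCartesianClosed C
    strongClassifier       : SubobjectClassifier C (StrongMono C)

------------------------------------------------------------------------
-- Bicoloured graphs

data Colour : Set where
  blue red : Colour

-- The objects V, E, E′ are `vertex`, `edge blue`, `edge red`.
data ShapeObj : Set where
  vertex : ShapeObj
  edge   : Colour → ShapeObj

data ShapeHom : ShapeObj → ShapeObj → Set where
  id      : ∀ {x} → ShapeHom x x
  src tgt : ∀ {c} → ShapeHom (edge c) vertex

-- This is the category written Cᵒᵖ, so graphs are covariant functors on it.
Shapeᵒᵖ : Category 0ℓ 0ℓ 0ℓ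
Shapeᵒᵖ = record
  { Obj       = ShapeObj
  ; _⇒_       = ShapeHom
  ; _≈_       = _≡_
  ; id        = id
  ; _∘_       = _∘_
  ; equiv     = ≡.isEquivalence
  ; assoc     = λ {_} {_} {_} {_} {f} {g} {k} → assoc f g k
  ; identityˡ = ≡.refl
  ; identityʳ = λ {_} {_} {f} → identityʳ f
  ; ∘-resp-≈  = ≡.cong₂ _∘_
  }
  where
  _∘_ : ∀ {x y z} → ShapeHom y z → ShapeHom x y → ShapeHom x z
  id  ∘ f  = f
  src ∘ id = src
  tgt ∘ id = tgt

  identityʳ : ∀ {x y} (f : ShapeHom x y) → f ∘ id ≡ f
  identityʳ id  = ≡.refl
  identityʳ src = ≡.refl
  identityʳ tgt = ≡.refl

  assoc : ∀ {w x y z} (f : ShapeHom w x) (g : ShapeHom x y) (k : ShapeHom y z) →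
          (k ∘ g) ∘ f ≡ k ∘ (g ∘ f)
  assoc f  g  id  = ≡.refl
  assoc id id src = ≡.refl
  assoc id id tgt = ≡.refl

BiColGraph : ∀ ℓ → Category (lsuc ℓ) ℓ ℓ
BiColGraph ℓ = Functors Shapeᵒᵖ (Sets ℓ)

module _ {ℓ : Level} (G : Category.Obj (BiColGraph ℓ)) where
  open Functor G

  Parallel : ∀ c (x y : Setoid.Carrier (F₀ (edge c))) → Set ℓ
  Parallel c x y = (F₁ src ⟨$⟩ x ≈ F₁ src ⟨$⟩ y) × (F₁ tgt ⟨$⟩ x ≈ F₁ tgt ⟨$⟩ y)
    where open Setoid (F₀ vertex)

  SimpleIn : Colour → Set ℓ
  SimpleIn c = ∀ x y → Parallel c x y → x ≈ y
    where open Setoid (F₀ (edge c))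

PartiallySimple : ∀ ℓ → Colour → Category (lsuc ℓ) ℓ ℓ
PartiallySimple ℓ c = FullSubcategory (BiColGraph ℓ) (λ G → SimpleIn G c)

{-# OPTIONS --safe #-}

-- A graph is partially simple iff its edges of the simple colour are
-- determined by their images under the arrows into the other objects of the
-- shape.  More generally, for a set D of objects of a small category J, call a
-- functor J → Set separated if its elements are determined by their images
-- under the arrows into D.  Separated functors form a quasitopos: they are
-- reflective in all functors (coarsen the equality) and closed under limits
-- and under exponentials in slices.  The image of a strong monomorphism
-- contains every element whose images under all arrows into D it contains, so
-- strong subobjects are classified by sieves compared on arrows into D only.
module Submission where

open import Defs
open import Level using (Level; _⊔_; 0ℓ) renaming (suc to lsuc)
open import Axiom.ExcludedMiddle using (ExcludedMiddle)
open import Data.Bool.Base using (Bool; true)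
open import Data.Bool.Properties using (⇔→≡)
open import Data.Product using (Σ; ∃!; _×_; _,_; proj₁; proj₂)
open import Data.Unit.Polymorphic using (tt) renaming (⊤ to Unit)
open import Function.Bundles using (Func; _⟨$⟩_; mk⇔)
open import Relation.Binary.Bundles using (Setoid)
import Relation.Binary.Construct.Closure.Equivalence as EqClosure
open EqClosure using (EqClosure)
open import Relation.Binary.PropositionalEquality as ≡ using (_≡_; _≢_)
open import Relation.Nullary.Decidable using (Dec; does; yes; no; dec-true)
open import Relation.Nullary.Negation using (contradiction)

private
  variable
    o h e o′ h′ e′ p : Level

-- Limits and colimits in full subcategories

module _ {C : Category o h e} {P : Category.Obj C → Set p} {J : Category o′ h′ e′}
         (F : Functor J (FullSubcategory C P)) where
  private
    module C = Category C

  forget : Functor J C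
  forget = record
    { F₀           = λ j → proj₁ (F₀ j)
    ; F₁           = F₁
    ; F-resp-≈     = F-resp-≈
    ; identity     = identity
    ; homomorphism = homomorphism
    }
    where open Functor F

  fullSubcategory-limit : (L : Limit forget) → P (Cone.apex (Limit.cone L)) → Limit F
  fullSubcategory-limit L p = record
    { cone      = record
      { apex    = Cone.apex (Limit.cone L) , p
      ; π       = Cone.π (Limit.cone L)
      ; commute = Cone.commute (Limit.cone L)
      }
    ; universal = λ K → Limit.universal L record
      { apex    = proj₁ (Cone.apex K)
      ; π       = Cone.π K
      ; commute = Cone.commute K
      }
    }

  -- A cocone with vertex in `P` factors uniquely through the ambient colimit and then uniquely
  -- through `unit`. A universal arrow from this one object into `P` suffices; no reflection functor
  -- is assumed.
  reflection-colimit :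
    (L : Colimit forget) (let open Cocone (Colimit.cocone L)) →
    (R : Category.Obj C) (pR : P R) (unit : coapex C.⇒ R) →
    (∀ {B} → P B → (f : coapex C.⇒ B) →
     ∃! C._≈_ λ (u : R C.⇒ B) → u C.∘ unit C.≈ f) →
    Colimit F
  reflection-colimit L R pR unit extend = record
    { cocone    = record
      { coapex  = R , pR
      ; ι       = λ j → unit C.∘ ι j
      ; commute = λ f → C.Equiv.trans C.assoc (C.∘-resp-≈ C.Equiv.refl (commute f))
      }
    ; universal = λ K →
        let (u , u-ι , u-unique) = Colimit.universal L record
              { coapex  = proj₁ (Cocone.coapex K)
              ; ι       = Cocone.ι K
              ; commute = Cocone.commute K
              }
            (v , v-unit , v-unique) = extend (proj₂ (Cocone.coapex K)) u
        in v
         , (λ j → C.Equiv.trans (C.Equiv.sym C.assoc)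
                  (C.Equiv.trans (C.∘-resp-≈ v-unit C.Equiv.refl) (u-ι j)))
         , λ w-ι → v-unique (C.Equiv.sym (u-unique λ j →
             C.Equiv.trans C.assoc (w-ι j)))
    }
    where open Cocone (Colimit.cocone L)

-- Cartesian closure from the slice over the terminal object

module _ {C : Category o h e} (T : Terminal C)
         (S : CartesianClosed (Slice C (Terminal.⊤ T))) where
  open Category C
  open Terminal T
  private
    module S = CartesianClosed S
    module SP {A B} = Product (S.product A B)
    open Category (Slice C ⊤) using () renaming (_∘_ to _∘/_)

    over : Obj → Category.Obj (Slice C ⊤)
    over A = A , !

    -- This turns every arrow of `C` into an arrow of the slice over `⊤`, so universal properties in
    -- the slice descend to `C`.
    triangle : ∀ {A B} {f : A ⇒ ⊤} {g : B ⇒ ⊤} {k : A ⇒ B} → g ∘ k ≈ f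
    triangle = Equiv.trans (Equiv.sym (!-unique _)) (!-unique _)

    product : ∀ A B → Product C A B
    product A B = record
      { A×B       = proj₁ A×B
      ; π₁        = proj₁ π₁
      ; π₂        = proj₁ π₂
      ; universal = λ {X} f g →
          let (u , eqs , unique) = universal {over X} (f , triangle) (g , triangle)
          in proj₁ u , eqs , λ eqs′ → unique {_ , triangle} eqs′
      }
      where open Product (S.product (over A) (over B))

    module P {A B} = Product (product A B)

    -- The structure map of a slice exponential is equal to ! only up to ≈,
    -- so its product with A has to be compared with `product`.
    exponential : ∀ A B → Exponential C product A B
    exponential A B = record
      { B^A       = proj₁ B^A
      ; eval      = proj₁ eval ∘ compare
      ; universal = λ {X} g →
          let (u , eval-u , unique) = universal {over X} (g , triangle)
          in proj₁ u
           , Equiv.trans (compared (proj₁ u) (proj₂ u)) eval-u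
           , λ {v} eval-v → unique {v , triangle}
               (Equiv.trans (Equiv.sym (compared v triangle)) eval-v)
      }
      where
      open Exponential (S.exponential (over A) (over B))
      module Q = Product (S.product B^A (over A))

      compare-universal = Q.universal {over (P.A×B {proj₁ B^A} {A})}
                            (P.π₁ , triangle) (P.π₂ , triangle)

      compare = proj₁ (proj₁ compare-universal)

      π₁-compare = proj₁ (proj₁ (proj₂ compare-universal))
      π₂-compare = proj₂ (proj₁ (proj₂ compare-universal))

      -- After `eval` is split off, both sides are arrows into the product `Q` with projections
      -- `u ∘ P.π₁` and `P.π₂`, so uniqueness of pairing equates them.
      compared : ∀ {X} (u : X ⇒ proj₁ B^A) (t : proj₂ B^A ∘ u ≈ !) →
                 (proj₁ eval ∘ compare) ∘ P.⟨ u ∘ P.π₁ , P.π₂ ⟩ ≈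
                 proj₁ eval ∘ proj₁ Q.⟨ (u , t) ∘/ SP.π₁ {over X} , SP.π₂ ⟩
      compared {X} u t = Equiv.trans assoc (∘-resp-≈ Equiv.refl (Equiv.sym
        (proj₂ (proj₂ (Q.universal _ _)) {compare ∘ P.⟨ u ∘ P.π₁ , P.π₂ ⟩ , triangle}
          ( Equiv.trans (Equiv.sym assoc)
              (Equiv.trans (∘-resp-≈ π₁-compare Equiv.refl) π₁-pair)
          , Equiv.trans (Equiv.sym assoc)
              (Equiv.trans (∘-resp-≈ π₂-compare Equiv.refl) π₂-pair)))))
        where
        pair-universal = P.universal (u ∘ P.π₁ {X} {A}) P.π₂
        π₁-pair = proj₁ (proj₁ (proj₂ pair-universal))
        π₂-pair = proj₂ (proj₁ (proj₂ pair-universal))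

  slice⊤⇒cartesianClosed : CartesianClosed C
  slice⊤⇒cartesianClosed = record
    { terminal    = T
    ; product     = product
    ; exponential = exponential
    }

-- Cartesian closed slices of a full subcategory

module _ {C : Category o h e} {P : Category.Obj C → Set p}
         (X : Category.Obj (FullSubcategory C P))
         (S : CartesianClosed (Slice C (proj₁ X))) where
  open CartesianClosed S

  fullSubcategory-sliceCartesianClosed :
    P (proj₁ (Terminal.⊤ terminal)) →
    (∀ A B → P (proj₁ A) → P (proj₁ B) → P (proj₁ (Product.A×B (product A B)))) →
    (∀ A B → P (proj₁ A) → P (proj₁ B) → P (proj₁ (Exponential.B^A (exponential A B)))) →
    CartesianClosed (Slice (FullSubcategory C P) X)
  fullSubcategory-sliceCartesianClosed P-⊤ P-× P-^ = record
    { terminal    = record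
      { ⊤        = into (Terminal.⊤ terminal) P-⊤
      ; !        = Terminal.! terminal
      ; !-unique = Terminal.!-unique terminal
      }
    ; product     = λ A B → let open Product (product (out A) (out B)) in record
      { A×B       = into A×B (P-× (out A) (out B) (holds A) (holds B))
      ; π₁        = π₁
      ; π₂        = π₂
      ; universal = universal
      }
    ; exponential = λ A B → let open Exponential (exponential (out A) (out B)) in record
      { B^A       = into B^A (P-^ (out A) (out B) (holds A) (holds B))
      ; eval      = eval
      ; universal = universal
      }
    }
    where
    open Category (Slice C (proj₁ X)) using () renaming (Obj to Over)
    open Category (Slice (FullSubcategory C P) X) using () renaming (Obj to Overᴾ)

    into : (A : Over) → P (proj₁ A) → Overᴾ
    into (A , a) pA = (A , pA) , a

    out : Overᴾ → Over
    out ((A , _) , a) = A , a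

    holds : (A : Overᴾ) → P (proj₁ (out A))
    holds ((_ , pA) , _) = pA

-- Presheaf categories

module Presheaves (J : Category 0ℓ 0ℓ 0ℓ) (ℓ : Level) where
  private
    module J = Category J

  𝒫 : Category (lsuc ℓ) ℓ ℓ
  𝒫 = Functors J (Sets ℓ)

  open Category 𝒫 public using (_⇒_; _∘_; _≈_) renaming (Obj to Presheaf)

  module At (A : Presheaf) (s : J.Obj) = Setoid (Functor.F₀ A s)

  infix 9 _·_

  act : (A : Presheaf) → ∀ {s r} → s J.⇒ r → At.Carrier A s → At.Carrier A r
  act A f x = Functor.F₁ A f ⟨$⟩ x

  act-cong : (A : Presheaf) → ∀ {s r} (f : s J.⇒ r) {x y} →
             At._≈_ A s x y → At._≈_ A r (act A f x) (act A f y)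
  act-cong A f = Func.cong (Functor.F₁ A f)

  _·_ : ∀ {A B : Presheaf} → A ⇒ B → ∀ {s} → At.Carrier A s → At.Carrier B s
  α · x = NatTrans.η α _ ⟨$⟩ x

  ·-cong : ∀ {A B : Presheaf} (α : A ⇒ B) {s} {x y : At.Carrier A s} →
           At._≈_ A s x y → At._≈_ B s (α · x) (α · y)
  ·-cong α = Func.cong (NatTrans.η α _)

  -- Pointwise limits and colimits

  module _ {I : Category 0ℓ 0ℓ 0ℓ} (F : Functor I 𝒫) where
    private
      module I = Category I
      module F = Functor F

    limitObject : Presheaf
    limitObject = record
      { F₀           = λ s → record
        { Carrier       = Σ (∀ i → At.Carrier (F.F₀ i) s) λ x →
                          ∀ {i j} (f : i I.⇒ j) → At._≈_ (F.F₀ j) s (F.F₁ f · x i) (x j)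
        ; _≈_           = λ (x , _) (y , _) → ∀ i → At._≈_ (F.F₀ i) s (x i) (y i)
        ; isEquivalence = record
          { refl  = λ i → At.refl (F.F₀ i) s
          ; sym   = λ p i → At.sym (F.F₀ i) s (p i)
          ; trans = λ p q i → At.trans (F.F₀ i) s (p i) (q i)
          }
        }
      ; F₁           = λ {s} {r} g → record
        { to   = λ (x , compatible) → (λ i → act (F.F₀ i) g (x i)) , λ {i} {j} f →
            At.trans (F.F₀ j) r (NatTrans.natural (F.F₁ f) g (x i))
                                (act-cong (F.F₀ j) g (compatible f))
        ; cong = λ p i → act-cong (F.F₀ i) g (p i)
        }
      ; F-resp-≈     = λ p (x , _) i → Functor.F-resp-≈ (F.F₀ i) p (x i)
      ; identity     = λ (x , _) i → Functor.identity (F.F₀ i) (x i)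
      ; homomorphism = λ (x , _) i → Functor.homomorphism (F.F₀ i) (x i)
      }

    limit : Limit F
    limit = record
      { cone      = record
        { apex    = limitObject
        ; π       = λ i → record
          { η       = λ s → record { to = λ (x , _) → x i ; cong = λ p → p i }
          ; natural = λ {s} {r} f x → At.refl (F.F₀ i) r
          }
        ; commute = λ f s (x , compatible) → compatible f
        }
      ; universal = λ K → let open Cone K in
          record
          { η       = λ s → record
            { to   = λ x → (λ i → π i · x) , λ f → commute f s x
            ; cong = λ p i → ·-cong (π i) p
            }
          ; natural = λ f x i → NatTrans.natural (π i) f x
          }
        , (λ i s x → At.refl (F.F₀ i) s)
        , λ eq s x i → At.sym (F.F₀ i) s (eq i s x)
      }

    private
      Point : J.Obj → Set ℓ
      Point s = Σ I.Obj λ i → At.Carrier (F.F₀ i) s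

      -- Asking for the target only up to `≈` lets the identity arrow of `I` generate the equality
      -- of each `F₀ i`, so the closure contains it (`≈⇒∼`).
      _↝_ : ∀ {s} → Point s → Point s → Set ℓ
      _↝_ {s} (i , x) (j , y) = Σ (i I.⇒ j) λ f → At._≈_ (F.F₀ j) s (F.F₁ f · x) y

      generate : ∀ {s} {x y : Point s} → x ↝ y → EqClosure _↝_ x y
      generate = EqClosure.return

      ≈⇒∼ : ∀ {s i} {x y : At.Carrier (F.F₀ i) s} → At._≈_ (F.F₀ i) s x y →
            EqClosure _↝_ (i , x) (i , y)
      ≈⇒∼ {s} {i} {x} p = generate (I.id , At.trans (F.F₀ i) s (F.identity s x) p)

    -- The quotient of the disjoint union by zigzags: the carrier stays the union and only its
    -- equality changes.
    colimitObject : Presheaf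
    colimitObject = record
      { F₀           = λ s → EqClosure.setoid (_↝_ {s})
      ; F₁           = λ {s} {r} g → record
        { to   = λ (i , x) → i , act (F.F₀ i) g x
        ; cong = EqClosure.gmap _ λ { {i , x} {j , y} (f , p) → f ,
            At.trans (F.F₀ j) r (NatTrans.natural (F.F₁ f) g x) (act-cong (F.F₀ j) g p) }
        }
      ; F-resp-≈     = λ p (i , x) → ≈⇒∼ (Functor.F-resp-≈ (F.F₀ i) p x)
      ; identity     = λ (i , x) → ≈⇒∼ (Functor.identity (F.F₀ i) x)
      ; homomorphism = λ (i , x) → ≈⇒∼ (Functor.homomorphism (F.F₀ i) x)
      }

    colimit : Colimit F
    colimit = record
      { cocone    = record
        { coapex  = colimitObject
        ; ι       = λ i → record
          { η       = λ s → record
            { to   = i ,_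
            ; cong = λ p → ≈⇒∼ p
            }
          ; natural = λ f x → EqClosure.reflexive _↝_
          }
        ; commute = λ {i} {j} f s x → EqClosure.symmetric _↝_
            (generate (f , At.refl (F.F₀ j) s))
        }
      ; universal = λ K → let open Cocone K in
          record
          { η       = λ s → record
            { to   = λ (i , x) → ι i · x
            -- A cocone identifies the two ends of a single step, hence of every zigzag, because
            -- equality in `coapex` is an equivalence.
            ; cong = EqClosure.gfold (At.isEquivalence coapex s) _
                λ { {i , x} {j , y} (f , p) →
                  At.trans coapex s (At.sym coapex s (commute f s x)) (·-cong (ι j) p) }
            }
          ; natural = λ f (i , x) → NatTrans.natural (ι i) f x
          }
        , (λ i s x → At.refl coapex s)
        , λ eq s (i , x) → At.sym coapex s (eq i s x)
      }

  terminalObject : Presheaf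
  terminalObject = record
    { F₀           = λ s → record
      { Carrier       = Unit
      ; _≈_           = λ _ _ → Unit
      ; isEquivalence = record {}
      }
    ; F₁           = λ f → record {}
    ; F-resp-≈     = λ _ _ → tt
    ; identity     = λ _ → tt
    ; homomorphism = λ _ → tt
    }

  terminal : Terminal 𝒫
  terminal = record
    { ⊤        = terminalObject
    ; !        = record { η = λ s → record {} ; natural = λ _ _ → tt }
    ; !-unique = λ _ _ _ → tt
    }

  -- Cartesian closure of the slices

  module _ (X : Presheaf) where
    private
      module X = At X

    module _ {A B : Presheaf} (a : A ⇒ X) (b : B ⇒ X) where
      private
        module A = At A
        module B = At B

      -- Serves as the product of `a` and `b` over `X`, and later, with both legs equal, as a kernel
      -- pair.
      pullbackObject : Presheaf
      pullbackObject = record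
        { F₀           = λ s → record
          { Carrier       = Σ (A.Carrier s × B.Carrier s) λ (x , y) →
                            X._≈_ s (a · x) (b · y)
          ; _≈_           = λ ((x , y) , _) ((x′ , y′) , _) →
                            A._≈_ s x x′ × B._≈_ s y y′
          ; isEquivalence = record
            { refl  = A.refl s , B.refl s
            ; sym   = λ (p , q) → A.sym s p , B.sym s q
            ; trans = λ (p , q) (p′ , q′) → A.trans s p p′ , B.trans s q q′
            }
          }
        ; F₁           = λ {s} {r} f → record
          { to   = λ ((x , y) , p) → (act A f x , act B f y) ,
              X.trans r (NatTrans.natural a f x)
              (X.trans r (act-cong X f p) (X.sym r (NatTrans.natural b f y)))
          ; cong = λ (p , q) → act-cong A f p , act-cong B f q
          }
        ; F-resp-≈     = λ p ((x , y) , _) → Functor.F-resp-≈ A p x , Functor.F-resp-≈ B p y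
        ; identity     = λ ((x , y) , _) → Functor.identity A x , Functor.identity B y
        ; homomorphism = λ ((x , y) , _) → Functor.homomorphism A x , Functor.homomorphism B y
        }

      projection₁ : pullbackObject ⇒ A
      projection₁ = record
        { η       = λ s → record { to = λ ((x , _) , _) → x ; cong = proj₁ }
        ; natural = λ {s} {r} f _ → A.refl r
        }

      projection₂ : pullbackObject ⇒ B
      projection₂ = record
        { η       = λ s → record { to = λ ((_ , y) , _) → y ; cong = proj₂ }
        ; natural = λ {s} {r} f _ → B.refl r
        }

      pair : ∀ {Y} (f : Y ⇒ A) (g : Y ⇒ B) → a ∘ f ≈ b ∘ g → Y ⇒ pullbackObject
      pair f g p = record
        { η       = λ s → record
          { to   = λ y → (f · y , g · y) , p s y
          ; cong = λ q → ·-cong f q , ·-cong g q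
          }
        ; natural = λ h y → NatTrans.natural f h y , NatTrans.natural g h y
        }

    sliceProduct : ∀ A B → Product (Slice 𝒫 X) A B
    sliceProduct (A , a) (B , b) = record
      { A×B       = pullbackObject a b , a ∘ projection₁ a b
      ; π₁        = projection₁ a b , λ s _ → X.refl s
      ; π₂        = projection₂ a b , λ s (_ , p) → X.sym s p
      ; universal = λ (f , a∘f) (g , b∘g) →
          ( pair a b f g (λ s y → X.trans s (a∘f s y) (X.sym s (b∘g s y))) , a∘f )
        , ((λ s _ → At.refl A s) , (λ s _ → At.refl B s))
        , λ (p , q) s y → At.sym A s (p s y) , At.sym B s (q s y)
      }

    sliceTerminal : Terminal (Slice 𝒫 X)
    sliceTerminal = record
      { ⊤        = X , Category.id 𝒫
      ; !        = λ {(A , a)} → a , λ s _ → X.refl s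
      ; !-unique = λ (f , p) s y → X.sym s (p s y)
      }

    module _ {A B : Presheaf} (a : A ⇒ X) (b : B ⇒ X) where
      private
        module A = At A
        module B = At B

      -- By the Yoneda lemma an element at s of the exponential over X consists
      -- of an element of X at s, i.e. a map into X from the representable
      -- presheaf of s, and of a map over X to B from its pullback along a.
      record FibreMap (s : J.Obj) : Set ℓ where
        field
          base    : X.Carrier s
          fun     : ∀ {r} (f : s J.⇒ r) (x : A.Carrier r) →
                    X._≈_ r (a · x) (act X f base) → B.Carrier r
          over    : ∀ {r} (f : s J.⇒ r) x p → X._≈_ r (b · fun f x p) (act X f base)
          resp    : ∀ {r} {f f′ : s J.⇒ r} {x x′} p p′ → f J.≈ f′ → A._≈_ r x x′ →
                    B._≈_ r (fun f x p) (fun f′ x′ p′)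
          natural : ∀ {r t} (g : r J.⇒ t) (f : s J.⇒ r) x p p′ →
                    B._≈_ t (act B g (fun f x p)) (fun (g J.∘ f) (act A g x) p′)
      open FibreMap

      restrict : ∀ {s r} → s J.⇒ r → FibreMap s → FibreMap r
      restrict {s} {r} k σ = record
        { base    = act X k (base σ)
        ; fun     = λ f x p → fun σ (f J.∘ k) x (lift p)
        ; over    = λ {t} f x p → X.trans t (over σ (f J.∘ k) x (lift p))
                                            (Functor.homomorphism X (base σ))
        ; resp    = λ p p′ f≈f′ → resp σ (lift p) (lift p′) (J.∘-resp-≈ f≈f′ J.Equiv.refl)
        ; natural = λ {t} {v} g f x p p′ → B.trans v
            (natural σ g (f J.∘ k) x (lift p)
              (X.trans v (lift p′) (Functor.F-resp-≈ X J.assoc (base σ))))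
            (resp σ _ (lift p′) (J.Equiv.sym J.assoc) (A.refl v))
        }
        where
        -- Functoriality of `X` turns the fibre condition for the restricted element into the one
        -- that `σ` expects.
        lift : ∀ {t} {f : r J.⇒ t} {x} → X._≈_ t (a · x) (act X f (act X k (base σ))) →
               X._≈_ t (a · x) (act X (f J.∘ k) (base σ))
        lift {t} p = X.trans t p (X.sym t (Functor.homomorphism X (base σ)))

      -- Values are compared at arbitrary proofs `p` and `p′`, since `resp` makes them independent
      -- of the proof. For transitivity the intermediate proof is transported along the equality of
      -- bases.
      exponentialObject : Presheaf
      exponentialObject = record
        { F₀           = λ s → record
          { Carrier       = FibreMap s
          ; _≈_           = λ σ τ → X._≈_ s (base σ) (base τ) ×
              (∀ {r} (f : s J.⇒ r) x p p′ → B._≈_ r (fun σ f x p) (fun τ f x p′))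
          ; isEquivalence = record
            { refl  = λ {σ} → X.refl s , λ {r} f x p p′ →
                resp σ p p′ J.Equiv.refl (A.refl r)
            ; sym   = λ (p , q) → X.sym s p , λ {r} f x u v → B.sym r (q f x v u)
            ; trans = λ (p , q) (p′ , q′) → X.trans s p p′ , λ {r} f x u v →
                let w = X.trans r u (act-cong X f p) in B.trans r (q f x u w) (q′ f x w v)
            }
          }
        ; F₁           = λ {s} {r} k → record
          { to   = restrict k
          ; cong = λ (p , q) → act-cong X k p , λ f x _ _ → q (f J.∘ k) x _ _
          }
        ; F-resp-≈     = λ p σ → Functor.F-resp-≈ X p (base σ) , λ {r} f x _ _ →
            resp σ _ _ (J.∘-resp-≈ J.Equiv.refl p) (A.refl r)
        ; identity     = λ σ → Functor.identity X (base σ) , λ {r} f x _ _ →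
            resp σ _ _ J.identityʳ (A.refl r)
        ; homomorphism = λ σ → Functor.homomorphism X (base σ) , λ {r} f x _ _ →
            resp σ _ _ (J.Equiv.sym J.assoc) (A.refl r)
        }

      exponentialProjection : exponentialObject ⇒ X
      exponentialProjection = record
        { η       = λ s → record { to = base ; cong = proj₁ }
        ; natural = λ {s} {r} f _ → X.refl r
        }

      -- As in the Yoneda lemma, the component at the identity is taken. Naturality compares the
      -- values at `J.id ∘ f`, coming from `restrict`, and at `f ∘ J.id`, coming from `natural`.
      evaluate : pullbackObject exponentialProjection a ⇒ B
      evaluate = record
        { η       = λ s → record
          { to   = λ ((σ , x) , p) → fun σ J.id x (at-id σ p)
          ; cong = λ { {(σ , x) , p} {(τ , y) , q} (u , v) →
              B.trans s (resp σ (at-id σ p) (X.trans s (·-cong a (A.sym s v)) (at-id σ p))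
                           J.Equiv.refl v)
                        (proj₂ u J.id y _ _) }
          }
        ; natural = λ {s} {r} f ((σ , x) , p) →
            let p′ = X.trans r (NatTrans.natural a f x)
                       (X.trans r (act-cong X f (X.sym s p))
                         (X.sym r (Functor.F-resp-≈ X J.identityʳ (base σ))))
            in B.trans r
                 (resp σ _ p′ (J.Equiv.trans J.identityˡ (J.Equiv.sym J.identityʳ)) (A.refl r))
                 (B.sym r (natural σ f J.id x (at-id σ p) p′))
        }
        where
        at-id : ∀ {s x} (σ : FibreMap s) → X._≈_ s (base σ) (a · x) →
                X._≈_ s (a · x) (act X J.id (base σ))
        at-id {s} σ p = X.trans s (X.sym s p) (X.sym s (Functor.identity X (base σ)))

      module _ {Y : Presheaf} (y : Y ⇒ X) (g : pullbackObject y a ⇒ B)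
               (g-over : b ∘ g ≈ y ∘ projection₁ y a) where
        private
          module Y = At Y

          at : ∀ {s r x} (f : s J.⇒ r) (z : Y.Carrier s) →
               X._≈_ r (a · x) (act X f (y · z)) → X._≈_ r (y · act Y f z) (a · x)
          at {r = r} f z p = X.trans r (NatTrans.natural y f z) (X.sym r p)

        curry : Y ⇒ exponentialObject
        curry = record
          { η       = λ s → record
            { to   = λ z → record
              { base    = y · z
              ; fun     = λ f x p → g · ((act Y f z , x) , at f z p)
              ; over    = λ {r} f x p → X.trans r (g-over r _) (NatTrans.natural y f z)
              ; resp    = λ p p′ f≈f′ x≈x′ → ·-cong g (Functor.F-resp-≈ Y f≈f′ z , x≈x′)
              ; natural = λ {r} {t} h f x p p′ → B.trans t
                  (B.sym t (NatTrans.natural g h ((act Y f z , x) , at f z p)))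
                  (·-cong g (Y.sym t (Functor.homomorphism Y z) , A.refl t))
              }
            ; cong = λ p → ·-cong y p , λ {r} f x _ _ →
                ·-cong g (act-cong Y f p , A.refl r)
            }
          ; natural = λ k z → NatTrans.natural y k z , λ {r} f x _ _ →
              ·-cong g (Y.sym r (Functor.homomorphism Y z) , A.refl r)
          }

        -- By naturality of `u`, the value of `u · z` at `f` is that of `u · act Y f z` at the
        -- identity, and this is the value that `evaluate` reads off.
        curry-unique : (u : Y ⇒ exponentialObject) (q : exponentialProjection ∘ u ≈ y) →
          (∀ {s} z x (p : X._≈_ s (y · z) (a · x)) p′ →
           B._≈_ s (evaluate · ((u · z , x) , p′)) (g · ((z , x) , p))) →
          curry ≈ u
        curry-unique u q eval-u s z =
            X.sym s (q s z)
          , λ {r} f x p p′ →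
              let v = X.trans r (q r (act Y f z)) (at f z p)
              in B.trans r (B.sym r (eval-u (act Y f z) x (at f z p) v))
                 (B.trans r (proj₂ (NatTrans.natural u f z) J.id x _
                               (X.trans r p′ (X.sym r (Functor.identity X _))))
                            (resp (u · z) _ _ J.identityˡ (A.refl r)))

    sliceExponential : ∀ A B → Exponential (Slice 𝒫 X) sliceProduct A B
    sliceExponential (A , a) (B , b) = record
      { B^A       = exponentialObject a b , exponentialProjection a b
      ; eval      = evaluate a b , λ s ((σ , x) , p) →
          X.trans s (FibreMap.over σ J.id x _) (Functor.identity X _)
      ; universal = λ {(Y , y)} (g , g-over) →
          (curry a b y g g-over , λ s _ → X.refl s)
        , (λ s ((z , x) , p) → ·-cong g (Functor.identity Y z , At.refl A s))
        , λ {(u , q)} eval-u → curry-unique a b y g g-over u q λ z x p p′ →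
            -- The given equation fixes one proof that the pair lies over `X`; `resp` carries it to
            -- any other.
            At.trans B _ (FibreMap.resp (u · z) _ _ J.Equiv.refl (At.refl A _))
                         (eval-u _ ((z , x) , p))
      }

    sliceCartesianClosed : CartesianClosed (Slice 𝒫 X)
    sliceCartesianClosed = record
      { terminal    = sliceTerminal
      ; product     = sliceProduct
      ; exponential = sliceExponential
      }

  -- Subobjects and images

  subobject : (B : Presheaf) (Q : ∀ {s} → At.Carrier B s → Set ℓ) →
              (∀ {s r} (f : s J.⇒ r) {x} → Q x → Q (act B f x)) → Presheaf
  subobject B Q Q-act = record
    { F₀           = λ s → record
      { Carrier       = Σ (At.Carrier B s) Q
      ; _≈_           = λ (x , _) (y , _) → At._≈_ B s x y
      ; isEquivalence = record
        { refl = At.refl B s ; sym = At.sym B s ; trans = At.trans B s }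
      }
    ; F₁           = λ f → record
      { to   = λ (x , q) → act B f x , Q-act f q
      ; cong = act-cong B f
      }
    ; F-resp-≈     = λ p (x , _) → Functor.F-resp-≈ B p x
    ; identity     = λ (x , _) → Functor.identity B x
    ; homomorphism = λ (x , _) → Functor.homomorphism B x
    }

  inclusion : ∀ B (Q : ∀ {s} → At.Carrier B s → Set ℓ)
              (Q-act : ∀ {s r} (f : s J.⇒ r) {x} → Q x → Q (act B f x)) →
              subobject B Q Q-act ⇒ B
  inclusion B Q Q-act = record
    { η       = λ s → record { to = proj₁ ; cong = λ p → p }
    ; natural = λ {s} {r} _ _ → At.refl B r
    }

  InImage : ∀ {A B} → A ⇒ B → ∀ {s} → At.Carrier B s → Set ℓ
  InImage {A} {B} m {s} y = Σ (At.Carrier A s) λ x → At._≈_ B s (m · x) y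

-- Separated presheaves

does⇒ : ∀ {a} {A : Set a} (a? : Dec A) → does a? ≡ true → A
does⇒ (yes a) _ = a

module SeparatedPresheaves (J : Category 0ℓ 0ℓ 0ℓ) (ℓ : Level)
                           (D : Category.Obj J → Set) where
  private
    module J = Category J
  open Presheaves J ℓ

  Agree : (G : Presheaf) → ∀ {s} (x y : At.Carrier G s) → Set ℓ
  Agree G {s} x y = ∀ {r} (f : s J.⇒ r) → D r → At._≈_ G r (act G f x) (act G f y)

  Separated : Presheaf → Set ℓ
  Separated G = ∀ {s} (x y : At.Carrier G s) → Agree G x y → At._≈_ G s x y

  -- The reflection onto separated functors

  reflect : Presheaf → Presheaf
  reflect G = record
    { F₀           = λ s → record
      { Carrier       = At.Carrier G s
      ; _≈_           = Agree G
      ; isEquivalence = record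
        { refl  = λ {x} f d → At.refl G _
        ; sym   = λ p f d → At.sym G _ (p f d)
        ; trans = λ p q f d → At.trans G _ (p f d) (q f d)
        }
      }
    ; F₁           = λ g → record
      { to   = act G g
      ; cong = λ {x} {y} p f d → At.trans G _ (At.sym G _ (Functor.homomorphism G x))
                 (At.trans G _ (p (f J.∘ g) d) (Functor.homomorphism G y))
      }
    ; F-resp-≈     = λ p x f d → act-cong G f (Functor.F-resp-≈ G p x)
    ; identity     = λ x f d → act-cong G f (Functor.identity G x)
    ; homomorphism = λ x f d → act-cong G f (Functor.homomorphism G x)
    }

  -- Equality in `reflect G` after an arrow `f` into `D` again tests all arrows into `D`, and the
  -- identity of the target of `f` is one of them.
  reflect-separated : ∀ G → Separated (reflect G)
  reflect-separated G x y p {r} f d =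
    At.trans G r (At.sym G r (Functor.identity G _))
      (At.trans G r (p f d J.id d) (Functor.identity G _))

  unit : ∀ G → G ⇒ reflect G
  unit G = record
    { η       = λ s → record { to = λ x → x ; cong = λ p f d → act-cong G f p }
    ; natural = λ f x g d → At.refl G _
    }

  -- Separatedness of `H` is what makes `f` respect the coarser equality. Existence and uniqueness
  -- are then immediate, as `unit` is the identity on elements.
  extend : ∀ {G H} → Separated H → (f : G ⇒ H) →
           ∃! _≈_ λ (u : reflect G ⇒ H) → u ∘ unit G ≈ f
  extend {G} {H} sep f =
      record
      { η       = λ s → record
        { to   = f ·_
        ; cong = λ {x} {y} p → sep (f · x) (f · y) λ {r} g d →
            At.trans H r (At.sym H r (NatTrans.natural f g x))
              (At.trans H r (·-cong f (p g d)) (NatTrans.natural f g y))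
        }
      ; natural = NatTrans.natural f
      }
    , (λ s x → At.refl H s)
    , λ eq s x → At.sym H s (eq s x)

  -- Closure properties of separated functors

  limit-separated : ∀ {I : Category 0ℓ 0ℓ 0ℓ} (F : Functor I 𝒫) →
                    (∀ i → Separated (Functor.F₀ F i)) → Separated (limitObject F)
  limit-separated F sep x y p i = sep i (proj₁ x i) (proj₁ y i) λ f d → p f d i

  subobject-separated : ∀ B (Q : ∀ {s} → At.Carrier B s → Set ℓ)
    (Q-act : ∀ {s r} (f : s J.⇒ r) {x} → Q x → Q (act B f x)) →
    Separated B → Separated (subobject B Q Q-act)
  subobject-separated B Q Q-act sep (x , _) (y , _) p = sep x y p

  module _ (X : Presheaf) {A B : Presheaf} (a : A ⇒ X) (b : B ⇒ X) where
    private
      module A = At A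
      module B = At B
      module X = At X
    open FibreMap

    pullback-separated : Separated A → Separated B → Separated (pullbackObject X a b)
    pullback-separated sepA sepB ((x , y) , _) ((x′ , y′) , _) p =
      sepA x x′ (λ f d → proj₁ (p f d)) , sepB y y′ (λ f d → proj₂ (p f d))

    -- Values lie in `B`, so it suffices to compare them after each arrow `g` into `D`. By `natural`
    -- they become values at `g ∘ f`, again an arrow into `D`; there the hypothesis equates the
    -- restrictions, which are evaluated at the identity.
    exponential-separated : Separated X → Separated B →
                            Separated (exponentialObject X a b)
    exponential-separated sepX sepB σ τ σ~τ =
        sepX _ _ (λ f d → proj₁ (σ~τ f d))
      , λ {r} f x p p′ → sepB _ _ λ {t} g d →
          let lift : ∀ ρ → X._≈_ r (a · x) (act X f (base ρ)) →
                     X._≈_ t (a · act A g x) (act X (g J.∘ f) (base ρ))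
              lift = λ ρ q → X.trans t (NatTrans.natural a g x)
                (X.trans t (act-cong X g q) (X.sym t (Functor.homomorphism X (base ρ))))
              at-id : ∀ ρ → X._≈_ r (a · x) (act X f (base ρ)) →
                      X._≈_ t (a · act A g x) (act X J.id (act X (g J.∘ f) (base ρ)))
              at-id = λ ρ q → X.trans t (lift ρ q) (X.sym t (Functor.identity X _))
          in B.trans t (natural σ g f x p (lift σ p))
             (B.trans t (resp σ _ _ (J.Equiv.sym J.identityˡ) (A.refl t))
             (B.trans t (proj₂ (σ~τ (g J.∘ f) d) J.id (act A g x) (at-id σ p) (at-id τ p′))
             (B.trans t (resp τ _ _ J.identityˡ (A.refl t))
                        (B.sym t (natural τ g f x p′ (lift τ p′))))))

  -- The classifier of strong subobjects

  -- As functors are covariant, these are sieves in the opposite of `J`. Membership valued in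
  -- `Set ℓ` would move the record up a universe; with `Bool` it stays in `Set ℓ`, and excluded
  -- middle supplies the truth values.
  record Sieve (s : J.Obj) : Set ℓ where
    field
      member : ∀ {r} → s J.⇒ r → Bool
      resp   : ∀ {r} {f g : s J.⇒ r} → f J.≈ g → member f ≡ member g
      closed : ∀ {r t} (f : s J.⇒ r) (g : r J.⇒ t) →
               member f ≡ true → member (g J.∘ f) ≡ true
  open Sieve

  -- Only the arrows into D are compared, which makes Ω separated.
  record _≋_ {s} (S T : Sieve s) : Set ℓ where
    constructor members
    field
      member-≡ : ∀ {r} (f : s J.⇒ r) → D r → member S f ≡ member T f
  open _≋_

  Ω : Presheaf
  Ω = record
    { F₀           = λ s → record
      { Carrier       = Sieve s
      ; _≈_           = _≋_
      ; isEquivalence = record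
        { refl  = members λ f d → ≡.refl
        ; sym   = λ p → members λ f d → ≡.sym (member-≡ p f d)
        ; trans = λ p q → members λ f d → ≡.trans (member-≡ p f d) (member-≡ q f d)
        }
      }
    ; F₁           = λ k → record
      { to   = λ S → record
        { member = λ f → member S (f J.∘ k)
        ; resp   = λ p → resp S (J.∘-resp-≈ p J.Equiv.refl)
        ; closed = λ f g m → ≡.trans (resp S J.assoc) (closed S (f J.∘ k) g m)
        }
      ; cong = λ p → members λ f d → member-≡ p (f J.∘ k) d
      }
    ; F-resp-≈     = λ p S → members λ f d → resp S (J.∘-resp-≈ J.Equiv.refl p)
    ; identity     = λ S → members λ f d → resp S J.identityʳ
    ; homomorphism = λ S → members λ f d → resp S (J.Equiv.sym J.assoc)
    }

  -- An arrow `f` belongs to `S` iff the identity belongs to the restriction of `S` along `f`.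
  Ω-separated : Separated Ω
  Ω-separated S T p = members λ f d → ≡.trans (resp S (J.Equiv.sym J.identityˡ))
    (≡.trans (member-≡ (p f d) J.id d) (resp T J.identityˡ))

  maximal : ∀ {s} → Sieve s
  maximal = record
    { member = λ f → true
    ; resp   = λ p → ≡.refl
    ; closed = λ f g m → ≡.refl
    }

  top : terminalObject ⇒ Ω
  top = record
    { η       = λ s → record
      { to   = λ _ → maximal
      ; cong = λ _ → members λ f d → ≡.refl
      }
    ; natural = λ f x → members λ g d → ≡.refl
    }

  Maximal : ∀ {s} → Sieve s → Set ℓ
  Maximal S = S ≋ maximal

  -- Together with `member-at`, this shows that `χ` is determined by the elements it sends to the
  -- maximal sieve. Here `closed` puts every `g ∘ f` into `χ · x`, whose restriction along `f` is
  -- `χ · act A f x`.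
  maximal-at : ∀ {A} (χ : A ⇒ Ω) {s r} (f : s J.⇒ r) → D r → ∀ x →
               member (χ · x) f ≡ true → Maximal (χ · act A f x)
  maximal-at χ f d x m = At.trans Ω _ (NatTrans.natural χ f x)
    (members λ g _ → closed (χ · x) f g m)

  member-at : ∀ {A} (χ : A ⇒ Ω) {s r} (f : s J.⇒ r) → D r → ∀ x →
              Maximal (χ · act A f x) → member (χ · x) f ≡ true
  member-at χ f d x p = ≡.trans (resp (χ · x) (J.Equiv.sym J.identityˡ))
    (member-≡ (At.trans Ω _ (At.sym Ω _ (NatTrans.natural χ f x)) p) J.id d)

  Maximal-act : ∀ {s r} (f : s J.⇒ r) {S : Sieve s} → Maximal S → Maximal (act Ω f S)
  Maximal-act f p = members λ g d → member-≡ p (g J.∘ f) d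

  -- The closure of the image; a strong monomorphism will turn out to have a closed image.
  DenseInImage : ∀ {A B} → A ⇒ B → ∀ {s} → At.Carrier B s → Set ℓ
  DenseInImage {_} {B} m {s} y = ∀ {r} (f : s J.⇒ r) → D r → InImage m (act B f y)

  DenseInImage-act : ∀ {A B} (m : A ⇒ B) {s r} (g : s J.⇒ r) {y} →
                     DenseInImage m y → DenseInImage m (act B g y)
  DenseInImage-act {_} {B} m g {y} p f d =
    let (x , q) = p (f J.∘ g) d
    in x , At.trans B _ q (Functor.homomorphism B y)

  -- For monic `m`, the elementwise form of being a pullback of `top` along `χ`.
  Classifies : ∀ {A B} → A ⇒ B → B ⇒ Ω → Set ℓ
  Classifies {A} {B} m χ = ∀ {s} (y : At.Carrier B s) →
    (InImage m y → Maximal (χ · y)) × (Maximal (χ · y) → InImage m y)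

  classifies-unique : ∀ {A B} (m : A ⇒ B) (χ χ′ : B ⇒ Ω) →
                      Classifies m χ → Classifies m χ′ → χ ≈ χ′
  classifies-unique m χ χ′ c c′ s y = members λ f d → ⇔→≡ (mk⇔
    (λ p → member-at χ′ f d y (proj₁ (c′ _) (proj₂ (c _) (maximal-at χ f d y p))))
    (λ p → member-at χ f d y (proj₁ (c _) (proj₂ (c′ _) (maximal-at χ′ f d y p)))))

  module _ (em : ExcludedMiddle ℓ) where

    image? : ∀ {A B} (m : A ⇒ B) {s} (y : At.Carrier B s) → Dec (InImage m y)
    image? m y = em

    characteristic : ∀ {A B} → A ⇒ B → B ⇒ Ω
    characteristic {A} {B} m = record
      { η       = λ s → record
        { to   = λ y → record
          { member = λ f → does (image? m (act B f y))
          ; resp   = λ p → image?-cong (Functor.F-resp-≈ B p y)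
          ; closed = λ f g p → let (x , q) = does⇒ (image? m (act B f y)) p in
              dec-true (image? m _)
                (act A g x , At.trans B _ (NatTrans.natural m g x)
                   (At.trans B _ (act-cong B g q) (At.sym B _ (Functor.homomorphism B y))))
          }
        ; cong = λ p → members λ f d → image?-cong (act-cong B f p)
        }
      ; natural = λ f y → members λ g d →
          image?-cong (At.sym B _ (Functor.homomorphism B y))
      }
      where
      image?-cong : ∀ {s} {y z : At.Carrier B s} → At._≈_ B s y z →
                    does (image? m y) ≡ does (image? m z)
      image?-cong {s} {y} {z} p = ⇔→≡ (mk⇔
        (λ q → let (x , q′) = does⇒ (image? m y) q in
               dec-true (image? m z) (x , At.trans B s q′ p))
        (λ q → let (x , q′) = does⇒ (image? m z) q in
               dec-true (image? m y) (x , At.trans B s q′ (At.sym B s p))))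

    -- Since `_≋_` sees only arrows into `D`, maximality of the sieve of `y` amounts to
    -- `DenseInImage m y`; the hypothesis takes this back to the image.
    characteristic-classifies : ∀ {A B} (m : A ⇒ B) →
      (∀ {s} {y : At.Carrier B s} → DenseInImage m y → InImage m y) →
      Classifies m (characteristic m)
    characteristic-classifies {A} {B} m dense y =
        (λ (x , p) → members λ f d → dec-true (image? m (act B f y))
          (act A f x , At.trans B _ (NatTrans.natural m f x) (act-cong B f p)))
      , λ p → dense λ f d → does⇒ (image? m (act B f y)) (member-≡ p f d)

  -- The quasitopos, for any predicate equivalent to separatedness

  module _ {p : Level} {P : Presheaf → Set p} (P⇒separated : ∀ {G} → P G → Separated G)
           (separated⇒P : ∀ {G} → Separated G → P G) where
    private
      𝒬 : Category (lsuc ℓ ⊔ p) ℓ ℓ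
      𝒬 = FullSubcategory 𝒫 P

      open Category 𝒬 using () renaming (Obj to Object)

      subobjectᴾ : (B : Object) (Q : ∀ {s} → At.Carrier (proj₁ B) s → Set ℓ) →
                   (∀ {s r} (f : s J.⇒ r) {x} → Q x → Q (act (proj₁ B) f x)) → Object
      subobjectᴾ (B , pB) Q Q-act =
        subobject B Q Q-act ,
        separated⇒P (subobject-separated B Q Q-act (P⇒separated pB))

    -- The kernel pair of `m` is separated, so its two projections are arrows of `𝒬` and cancelling
    -- `m` makes them equal.
    mono⇒injective : ∀ {A B : Object} (m : proj₁ A ⇒ proj₁ B) → Mono 𝒬 {A} {B} m →
      ∀ {s} {x y : At.Carrier (proj₁ A) s} →
      At._≈_ (proj₁ B) s (m · x) (m · y) → At._≈_ (proj₁ A) s x y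
    mono⇒injective {A , pA} {B , _} m mono {s} {x} {y} p =
      mono {kernelPair} (projection₁ B m m) (projection₂ B m m) (λ _ (_ , q) → q)
           s ((x , y) , p)
      where
      kernelPair : Object
      kernelPair = pullbackObject B m m ,
        separated⇒P (pullback-separated B m m (P⇒separated pA) (P⇒separated pA))

    -- Factor `m` through the closure of its image. The first factor is epic in `𝒬`, so the identity
    -- of `A` lifts along it, and the diagonal yields preimages.
    strongMono⇒imageClosed : ∀ {A B : Object} (m : proj₁ A ⇒ proj₁ B) → StrongMono 𝒬 {A} {B} m →
      ∀ {s} {y : At.Carrier (proj₁ B) s} → DenseInImage m y → InImage m y
    strongMono⇒imageClosed {A , pA} {B , pB} m (_ , lift) {s} {y} dense =
      let (d , _ , m∘d) = lift {A , pA} {closure} corestrict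
                            (λ {Z} → corestrict-epi {Z})
                            (Category.id 𝒫) (inclusion B (DenseInImage m) (DenseInImage-act m))
                            (λ t x → At.refl B t)
      in d · (y , dense) , m∘d s (y , dense)
      where
      closure : Object
      closure = subobjectᴾ (B , pB) (DenseInImage m) (DenseInImage-act m)

      corestrict : A ⇒ proj₁ closure
      corestrict = record
        { η       = λ t → record
          { to   = λ x → m · x , λ f _ → act A f x , NatTrans.natural m f x
          ; cong = ·-cong m
          }
        ; natural = NatTrans.natural m
        }

      -- In a separated target it suffices to compare after arrows into `D`, and these carry every
      -- element of the closure into the image of `m`.
      corestrict-epi : Epi 𝒬 {A , pA} {closure} corestrict
      corestrict-epi {Z , pZ} g h eq t (z , q) = P⇒separated pZ _ _ λ {r} f d →
        let (x , m·x) = q f d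
            module Z = At Z
        in Z.trans r (Z.sym r (NatTrans.natural g f (z , q)))
           (Z.trans r (Z.sym r (·-cong g m·x))
           (Z.trans r (eq r x)
           (Z.trans r (·-cong h m·x) (NatTrans.natural h f (z , q)))))

    terminalᴾ : Terminal 𝒬
    terminalᴾ = record
      { ⊤        = terminalObject , separated⇒P (λ _ _ _ → tt)
      ; !        = Terminal.! terminal
      ; !-unique = Terminal.!-unique terminal
      }

    open Terminal terminalᴾ

    Ωᴾ : Object
    Ωᴾ = Ω , separated⇒P Ω-separated

    -- Preimages come from applying the universal property to the subobject `truth` of elements with
    -- maximal sieve.
    pullback⇒classifies : ∀ {A B : Object} (m : proj₁ A ⇒ proj₁ B) (χ : proj₁ B ⇒ Ω) →
      IsPullback 𝒬 {A} {B} {⊤} {Ωᴾ} m (! {A}) χ top → Classifies m χ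
    pullback⇒classifies {A} {B} m χ (square , universal) {s} y =
        (λ (x , p) → At.trans Ω s (·-cong χ (At.sym (proj₁ B) s p)) (square s x))
      , λ q → let (u , (m∘u , _) , _) = universal {truth} (inclusion (proj₁ B) Q Q-act)
                                          (! {truth}) (λ t (_ , q) → q)
              in u · (y , q) , m∘u s (y , q)
      where
      Q : ∀ {s} → At.Carrier (proj₁ B) s → Set ℓ
      Q y = Maximal (χ · y)

      Q-act : ∀ {s r} (f : s J.⇒ r) {x} → Q x → Q (act (proj₁ B) f x)
      Q-act f {x} q = At.trans Ω _ (NatTrans.natural χ f x) (Maximal-act f q)

      truth : Object
      truth = subobjectᴾ B Q Q-act

    -- The mediating map takes preimages element by element; injectivity of `m` makes it respect
    -- equality, natural and unique.
    classifies⇒pullback : ∀ {A B : Object} (m : proj₁ A ⇒ proj₁ B) (χ : proj₁ B ⇒ Ω) →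
      Mono 𝒬 {A} {B} m → Classifies m χ →
      IsPullback 𝒬 {A} {B} {⊤} {Ωᴾ} m (! {A}) χ top
    classifies⇒pullback {A , pA} {B , pB} m χ mono c =
        (λ s x → proj₁ (c (m · x)) (x , B.refl s))
      , λ {X} g _ square →
          let preimage : ∀ {s} (x : At.Carrier (proj₁ X) s) → InImage m (g · x)
              preimage x = proj₂ (c (g · x)) (square _ x)
          in record
             { η       = λ s → record
               { to   = λ x → proj₁ (preimage x)
               ; cong = λ {x} {y} p → injective (B.trans s (proj₂ (preimage x))
                   (B.trans s (·-cong g p) (B.sym s (proj₂ (preimage y)))))
               }
             ; natural = λ {s} {r} f x → injective
                 (B.trans r (proj₂ (preimage (act (proj₁ X) f x)))
                 (B.trans r (NatTrans.natural g f x)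
                 (B.trans r (B.sym r (act-cong B f (proj₂ (preimage x))))
                            (B.sym r (NatTrans.natural m f (proj₁ (preimage x)))))))
             }
           , ((λ s x → proj₂ (preimage x)) , λ _ _ → tt)
           , λ (p , _) s x → injective
               (B.trans s (proj₂ (preimage x)) (B.sym s (p s x)))
      where
      module B = At B
      injective : ∀ {s} {x y : At.Carrier A s} → B._≈_ s (m · x) (m · y) → At._≈_ A s x y
      injective = mono⇒injective {A , pA} {B , pB} m λ {X} → mono {X}

    top-strongMono : StrongMono 𝒬 {⊤} {Ωᴾ} top
    top-strongMono =
        (λ f g _ _ _ → tt)
      -- As `top` is constant, `square` also reads as an equation between `(top ∘ !) ∘ q` and
      -- `g ∘ q`, and `q` cancels.
      , λ {X} {Y} q epi f g square →
          ! {Y} , (λ _ _ → tt) , epi {Ωᴾ} (top ∘ ! {Y}) g square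

    separated-isQuasitopos : ExcludedMiddle ℓ → IsQuasitopos 𝒬
    separated-isQuasitopos em = record
      { finiteLimits           = λ I _ F → fullSubcategory-limit F (limit (forget F))
          (separated⇒P (limit-separated (forget F)
            (λ i → P⇒separated (proj₂ (Functor.F₀ F i)))))
      -- The pointwise colimit need not be separated, so it is reflected.
      ; finiteColimits         = λ I _ F →
          let G = colimitObject (forget F) in
          reflection-colimit F (colimit (forget F)) (reflect G)
            (separated⇒P (reflect-separated G)) (unit G)
            (λ pH f → extend (P⇒separated pH) f)
      ; cartesianClosed        = slice⊤⇒cartesianClosed terminalᴾ (locallyCartesianClosed ⊤)
      ; locallyCartesianClosed = locallyCartesianClosed
      ; strongClassifier       = record
        { terminal = terminalᴾ
        ; Ω        = Ωᴾ
        ; true     = top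
        ; true∈M   = top-strongMono
        ; classify = λ {A} {B} m strong →
            let c = characteristic-classifies em m (strongMono⇒imageClosed {A} {B} m strong)
            in characteristic em m
             , classifies⇒pullback {A} {B} m (characteristic em m)
                 (λ {X} → proj₁ strong {X}) c
             , λ {χ} pb → classifies-unique m (characteristic em m) χ c
                            (pullback⇒classifies {A} {B} m χ pb)
        }
      }
      where
      locallyCartesianClosed : LocallyCartesianClosed 𝒬
      locallyCartesianClosed (X , pX) =
        fullSubcategory-sliceCartesianClosed (X , pX) (sliceCartesianClosed X) pX
          (λ (A , a) (B , b) pA pB → separated⇒P
            (pullback-separated X a b (P⇒separated pA) (P⇒separated pB)))
          (λ (A , a) (B , b) pA pB → separated⇒P
            (exponential-separated X a b (P⇒separated pX) (P⇒separated pB)))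

-- Graphs

_≟_ : (c d : Colour) → Dec (c ≡ d)
blue ≟ blue = yes ≡.refl
blue ≟ red  = no λ ()
red  ≟ blue = no λ ()
red  ≟ red  = yes ≡.refl

module _ {ℓ : Level} {c : Colour} where
  open SeparatedPresheaves Shapeᵒᵖ ℓ (_≢ edge c)

  -- Every object but `edge c` lies in `D`, so there the identity already recovers equality. From
  -- `edge c` the only arrows into `D` are `src` and `tgt`, so agreement means being parallel.
  simpleIn⇒separated : ∀ {G} → SimpleIn G c → Separated G
  simpleIn⇒separated {G} simple = at _
    where
    open Functor G

    unrestrict : ∀ {s} → s ≢ edge c → (x y : Setoid.Carrier (F₀ s)) →
                 Agree G x y → Setoid._≈_ (F₀ s) x y
    unrestrict {s} s≢c x y agree =
      trans (sym (identity x)) (trans (agree id s≢c) (identity y))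
      where open Setoid (F₀ s)

    at : ∀ s (x y : Setoid.Carrier (F₀ s)) → Agree G x y → Setoid._≈_ (F₀ s) x y
    at vertex   = unrestrict λ ()
    at (edge d) with d ≟ c
    ... | yes ≡.refl = λ x y agree → simple x y (agree src (λ ()) , agree tgt (λ ()))
    ... | no d≢c     = unrestrict λ { ≡.refl → d≢c ≡.refl }

  separated⇒simpleIn : ∀ {G} → Separated G → SimpleIn G c
  separated⇒simpleIn separated x y (src≈ , tgt≈) = separated x y λ where
    id  c≢c → contradiction ≡.refl c≢c
    src _   → src≈
    tgt _   → tgt≈

corollary59 : ∀ {ℓ : Level} → ExcludedMiddle ℓ → (c : Colour) → IsQuasitopos (PartiallySimple ℓ c)
corollary59 {ℓ} em c = separated-isQuasitopos
  (λ {G} → simpleIn⇒separated {G = G}) (λ {G} → separated⇒simpleIn {G = G}) em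
  where open SeparatedPresheaves Shapeᵒᵖ ℓ (_≢ edge c)
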